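{- Let $H$ and $H'$ be two three-card hands (three-element subsets of the 81-card SET deck). Then $H$ and $H'$ are isomorphic if and only if they have the same symbol.
   Context: **Deck.** Let $A=\{\text{color},\text{shape},\text{fill},\text{number}\}$ be the set of four attributes. For each $a\in A$ let $V_a$ be the set of three values of attribute $a$: $V_{\text{color}}=\{\text{red, green, purple}\}$, $V_{\text{shape}}=\{\text{oval, diamond, squiggle}\}$, $V_{\text{fill}}=\{\text{solid, empty, stripe}\}$, $V_{\text{number}}=\{\text{single, double, triple}\}$. The SET deck consists of $3^4=81$ cards, exactly one for each choice of a value in each attribute (that is, the deck is identified with $\prod_{a\in A}V_a$). For a card $x$ and $a\in A$, $v_a(x)\in V_a$ denotes the value of $x$ for attribute $a$. A hand is a subset of the deck. **Isomorphism.** Two hands $H$ and $H'$ are isomorphic if there exist a bijection $\varphi:H\to H'$, a permutation $\psi:A\to A$, and for each $a\in A$ a bijection $\vartheta_a:V_a\to V_{\psi(a)}$, such that $v_{\psi(a)}(\varphi(x))=\vartheta_a(v_a(x))$ for every $a\in A$ and every $x\in H$. **Symbol.** Let $H=\{x_1,x_2,x_3\}$ be a hand with exactly three cards. Its symbol is $(t;p_1,p_2,p_3)$, where the $p_i$'s are unordered (i.e. $\{p_1,p_2,p_3\}$ is regarded as a multiset). Here $t$ is the number of attributes $a\in A$ on which all three cards have the same value, and the $p_i$'s are, for each of the three pairs of cards of $H$, the number of attributes on which the two cards of that pair have the same value but which are not among the $t$ attributes common to all three cards. Two symbols are the same if their $t$'s are equal and their multisets of $p_i$'s are equal. -}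

module Defs where

open import Data.Bool.Base using (Bool; T)
open import Data.Fin.Base using (Fin)
open import Data.Fin.Patterns using (0F; 1F; 2F)
import Data.Fin.Properties as Fin
open import Data.List.Base using (List; []; _∷_; length; filter)
open import Data.List.Relation.Binary.Permutation.Propositional using (_↭_)
open import Data.Nat.Base using (ℕ)
open import Data.Product.Base using (Σ; _×_; proj₁)
open import Function.Base using (_∘_)
open import Function.Bundles using (_↔_; Inverse)
open import Relation.Binary.PropositionalEquality.Core using (_≡_; refl; cong)
open import Relation.Nullary.Decidable using (Dec; map′; _×-dec_; ¬?)
open import Relation.Nullary.Negation using (¬_)
open import Relation.Unary using (Pred; Decidable)
open import Level using (0ℓ)

data Attribute : Set where
  color shape fill number : Attribute

data V : Attribute → Set where
  red green purple      : V color
  oval diamond squiggle : V shape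
  solid empty stripe    : V fill
  single double triple  : V number

-- A record rather than the function type (a : Attribute) → V a, so that cards
-- with the same four values are propositionally equal.
record Card : Set where
  constructor card
  field
    v-color  : V color
    v-shape  : V shape
    v-fill   : V fill
    v-number : V number

v : (a : Attribute) → Card → V a
v color  = Card.v-color
v shape  = Card.v-shape
v fill   = Card.v-fill
v number = Card.v-number

Hand : Set
Hand = Card → Bool

-- T b has at most one inhabitant, so two elements of a hand are equal exactly
-- when their cards are.
Element : Hand → Set
Element H = Σ Card (T ∘ H)

⌊_⌋ : {H : Hand} → Element H → Card
⌊_⌋ = proj₁

record Isomorphic (H H′ : Hand) : Set where
  field
    φ : Element H ↔ Element H′
    ψ : Attribute ↔ Attribute
    ϑ : (a : Attribute) → V a ↔ V (Inverse.to ψ a)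
    compatible : (a : Attribute) (x : Element H) →
      v (Inverse.to ψ a) ⌊ Inverse.to φ x ⌋ ≡ Inverse.to (ϑ a) (v a ⌊ x ⌋)

index : {a : Attribute} → V a → Fin 3
index red      = 0F
index green    = 1F
index purple   = 2F
index oval     = 0F
index diamond  = 1F
index squiggle = 2F
index solid    = 0F
index empty    = 1F
index stripe   = 2F
index single   = 0F
index double   = 1F
index triple   = 2F

index-injective : {a : Attribute} (x y : V a) → index x ≡ index y → x ≡ y
index-injective red      red      _ = refl
index-injective green    green    _ = refl
index-injective purple   purple   _ = refl
index-injective oval     oval     _ = refl
index-injective diamond  diamond  _ = refl
index-injective squiggle squiggle _ = refl
index-injective solid    solid    _ = refl
index-injective empty    empty    _ = refl
index-injective stripe   stripe   _ = refl
index-injective single   single   _ = refl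
index-injective double   double   _ = refl
index-injective triple   triple   _ = refl

infix 4 _≟_

_≟_ : {a : Attribute} (x y : V a) → Dec (x ≡ y)
x ≟ y = map′ (index-injective x y) (cong index) (index x Fin.≟ index y)

attributes : List Attribute
attributes = color ∷ shape ∷ fill ∷ number ∷ []

#attributes : {P : Pred Attribute 0ℓ} → Decidable P → ℕ
#attributes P? = length (filter P? attributes)

Agree : Card → Card → Pred Attribute 0ℓ
Agree x y a = v a x ≡ v a y

agree? : (x y : Card) → Decidable (Agree x y)
agree? x y a = v a x ≟ v a y

record Symbol : Set where
  constructor ⟨_⨾_,_,_⟩
  field
    t p₁ p₂ p₃ : ℕ

infix 4 _≈_

_≈_ : Symbol → Symbol → Set
⟨ t ⨾ p₁ , p₂ , p₃ ⟩ ≈ ⟨ t′ ⨾ p₁′ , p₂′ , p₃′ ⟩ =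
  t ≡ t′ × (p₁ ∷ p₂ ∷ p₃ ∷ []) ↭ (p₁′ ∷ p₂′ ∷ p₃′ ∷ [])

module _ (x₁ x₂ x₃ : Card) where

  AllAgree : Pred Attribute 0ℓ
  AllAgree a = Agree x₁ x₂ a × Agree x₂ x₃ a

  allAgree? : Decidable AllAgree
  allAgree? a = agree? x₁ x₂ a ×-dec agree? x₂ x₃ a

  OnlyPairAgree : Card → Card → Pred Attribute 0ℓ
  OnlyPairAgree x y a = Agree x y a × ¬ AllAgree a

  onlyPairAgree? : (x y : Card) → Decidable (OnlyPairAgree x y)
  onlyPairAgree? x y a = agree? x y a ×-dec ¬? (allAgree? a)

  symbolOf : Symbol
  symbolOf =
    ⟨ #attributes allAgree?
    ⨾ #attributes (onlyPairAgree? x₁ x₂)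
    , #attributes (onlyPairAgree? x₁ x₃)
    , #attributes (onlyPairAgree? x₂ x₃)
    ⟩

-- An enumeration H = {x₁, x₂, x₃} without repetition; one exists exactly when
-- H has three cards.
ThreeCards : Hand → Set
ThreeCards H = Fin 3 ↔ Element H

-- The enumeration matters only up to _≈_: another one permutes the pᵢ.
symbol : {H : Hand} → ThreeCards H → Symbol
symbol e = symbolOf ⌊ Inverse.to e 0F ⌋ ⌊ Inverse.to e 1F ⌋ ⌊ Inverse.to e 2F ⌋

{-# OPTIONS --safe #-}

-- An attribute partitions the three cards of a hand by value, and bijections
-- between the value sets exist exactly between attributes inducing the same
-- partition.  There are five partitions of three cards: one block, one card
-- split off (three ways), and all distinct.  The symbol counts the attributes
-- inducing each of the first four, and the count of the fifth is forced by the
-- total.  So hands with the same symbol, once the cards are matched according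
-- to the pᵢ, have attributes that can be matched partition by partition.

module Submission where

open import Defs
import Algebra.Properties.CommutativeMonoid.Sum as Sum
open import Data.Bool.Base using (true; false)
open import Data.Fin.Base using (Fin; suc; cast)
open import Data.Fin.Patterns using (0F; 1F; 2F; 3F)
open import Data.Fin.Permutation as Perm
  using (Permutation; Permutation′; _⟨$⟩ʳ_; _∘ₚ_; lift₀; transpose; cast-id)
open import Data.Fin.Properties as Fin using (all?; any?; cast-involutive)
open import Data.List.Base
  using (List; []; _∷_; [_]; _++_; length; lookup; filter; map; replicate; tabulate)
open import Data.List.Properties
  using (filter-≐; length-++; length-replicate; length-tabulate; lookup-tabulate; tabulate-cong)
open import Data.List.Relation.Binary.Permutation.Propositional
  using (_↭_; ↭-refl; ↭-reflexive; ↭-sym; ↭-trans; ↭-prep; ↭⇒↭ₛ)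
open import Data.List.Relation.Binary.Permutation.Propositional.Properties
  using (++-commutativeMonoid; ++⁺ˡ; filter-↭; shift; ↭-length; ↭-reverse)
import Data.List.Relation.Binary.Permutation.Homogeneous as Homogeneous
import Data.List.Relation.Binary.Permutation.Setoid.Properties as Setoid↭
open import Data.Maybe.Base using (Maybe; just; nothing)
open import Data.Maybe.Properties using (≡-dec; just-injective)
open import Data.Nat.Base using (ℕ)
open import Data.Nat.Properties using (+-cancelˡ-≡)
open import Data.Product.Base using (∃; _×_; _,_; map₂; proj₁; proj₂)
open import Data.Sum.Base using (_⊎_; inj₁; inj₂)
open import Function.Base using (_∘_)
open import Function.Bundles using (_⇔_; _↔_; Equivalence; Injection; Inverse; mk⇔; mk↔ₛ′)
open import Function.Properties.Inverse using (↔-sym; ↔-trans; ↔⇒↣)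
open import Function.Construct.Symmetry using (⇔-sym)
open import Level using (0ℓ)
open import Relation.Binary.Definitions using (DecidableEquality)
open import Relation.Binary.PropositionalEquality
  using (_≡_; _≢_; _≗_; refl; sym; trans; cong; subst; subst₂; setoid; module ≡-Reasoning)
open import Relation.Nullary.Decidable
  using (Dec; does; yes; no; toWitness; _×-dec_; _⊎-dec_; _→-dec_; ¬?; dec-true)
open import Relation.Nullary.Negation using (¬_; contradiction)
open import Relation.Unary using (Pred; Decidable)

open Equivalence using () renaming (to to forward; from to backward)

private variable
  A B : Set
  m n : ℕ
  a b : Attribute

-- Lists and permutations

-- In the commutative monoid of lists up to `↭`, a tabulated list is the sum of its singletons, and
-- a finite sum is invariant under permuting its indices.
tabulate-permute : (f : Fin n → A) (π : Permutation m n) →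
  tabulate f ↭ tabulate (f ∘ (π ⟨$⟩ʳ_))
tabulate-permute {A = A} f π = subst₂ _↭_ (sum-[-] f) (sum-[-] _) (sum-permute ([_] ∘ f) π)
  where
  open Sum (++-commutativeMonoid {A = A})
  sum-[-] : ∀ {n} (f : Fin n → A) → sum ([_] ∘ f) ≡ tabulate f
  sum-[-] {ℕ.zero}  f = refl
  sum-[-] {ℕ.suc n} f = cong (f 0F ∷_) (sum-[-] (f ∘ suc))

tabulate-↭⇒permutation : (f : Fin m → A) (g : Fin n → A) → tabulate f ↭ tabulate g →
  ∃ λ (π : Permutation m n) → f ≗ g ∘ (π ⟨$⟩ʳ_)
tabulate-↭⇒permutation {A = A} f g p = π , f≗g∘π
  where
  open ≡-Reasoning
  p′ = ↭⇒↭ₛ p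
  ρ = Homogeneous.onIndices p′
  |f| = length-tabulate f
  |g| = length-tabulate g
  -- `ρ` acts on positions of the tabulated lists, whose lengths equal `m` and `n` only
  -- propositionally; hence the casts.
  π = cast-id (sym |f|) ∘ₚ ρ ∘ₚ cast-id |g|
  f≗g∘π : f ≗ g ∘ (π ⟨$⟩ʳ_)
  f≗g∘π i = let i′ = cast (sym |f|) i in begin
    f i                                                         ≡⟨ lookup-tabulate f i ⟨
    lookup (tabulate f) i′                                      ≡⟨ Setoid↭.onIndices-lookup (setoid A) p′ i′ ⟩
    lookup (tabulate g) (ρ ⟨$⟩ʳ i′)                             ≡⟨ cong (lookup (tabulate g)) (cast-involutive (sym |g|) |g| _) ⟨
    lookup (tabulate g) (cast (sym |g|) (cast |g| (ρ ⟨$⟩ʳ i′))) ≡⟨ lookup-tabulate g _ ⟩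
    g (π ⟨$⟩ʳ i)                                                ∎

length-filter-map : {P : Pred B 0ℓ} (P? : Decidable P) (f : A → B) (xs : List A) →
  length (filter P? (map f xs)) ≡ length (filter (P? ∘ f) xs)
length-filter-map P? f [] = refl
length-filter-map P? f (x ∷ xs) with does (P? (f x))
... | true  = cong ℕ.suc (length-filter-map P? f xs)
... | false = length-filter-map P? f xs

length-++-cancelˡ : (xs {ys zs} : List A) →
  length (xs ++ ys) ≡ length (xs ++ zs) → length ys ≡ length zs
length-++-cancelˡ xs {ys} {zs} eq = +-cancelˡ-≡ (length xs) _ _
  (subst₂ _≡_ (length-++ xs) (length-++ xs) eq)

-- just k stands for the k-th Cell below, nothing for three distinct values.
Label : Set
Label = Maybe (Fin 4)

_≟ˡ_ : DecidableEquality Label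
_≟ˡ_ = ≡-dec Fin._≟_

count : Label → List Label → ℕ
count l = length ∘ filter (l ≟ˡ_)

-- A normal form for lists of labels up to `↭`: one block per label, in a fixed order.
blocks : (Label → ℕ) → List Label
blocks c = block (just 0F) ++ block (just 1F) ++ block (just 2F) ++ block (just 3F) ++ block nothing
  where
  block : Label → List Label
  block l = replicate (c l) l

-- Insertion sort: each new head travels past the earlier blocks until it joins its own.
↭-blocks : (ls : List Label) → ls ↭ blocks (λ l → count l ls)
↭-blocks [] = ↭-refl
↭-blocks (l ∷ ls) = ↭-trans (↭-prep l (↭-blocks ls)) (insert l)
  where
  past : ∀ {l} (xs {ys zs} : List Label) → l ∷ ys ↭ zs → l ∷ xs ++ ys ↭ xs ++ zs
  past xs p = ↭-trans (↭-sym (shift _ xs _)) (++⁺ˡ xs p)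
  block : Fin 4 → List Label
  block k = replicate (count (just k) ls) (just k)
  insert : ∀ l → l ∷ blocks (λ l′ → count l′ ls) ↭ blocks (λ l′ → count l′ (l ∷ ls))
  insert (just 0F) = ↭-refl
  insert (just 1F) = past (block 0F) ↭-refl
  insert (just 2F) = past (block 0F) (past (block 1F) ↭-refl)
  insert (just 3F) = past (block 0F) (past (block 1F) (past (block 2F) ↭-refl))
  insert nothing   = past (block 0F) (past (block 1F) (past (block 2F) (past (block 3F) ↭-refl)))

-- Cancelling the four common blocks from the total length leaves the length of the block of
-- `nothing`.
blocks-length-injective : (c c′ : Label → ℕ) → (∀ k → c (just k) ≡ c′ (just k)) →
  length (blocks c) ≡ length (blocks c′) → blocks c ≡ blocks c′
blocks-length-injective c c′ c≡c′ len
  rewrite c≡c′ 0F | c≡c′ 1F | c≡c′ 2F | c≡c′ 3F =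
  cong (λ n → block 0F ++ block 1F ++ block 2F ++ block 3F ++ replicate n nothing) c-nothing
  where
  block : Fin 4 → List Label
  block k = replicate (c′ (just k)) (just k)
  c-nothing : c nothing ≡ c′ nothing
  c-nothing = subst₂ _≡_ (length-replicate (c nothing)) (length-replicate (c′ nothing))
    (length-++-cancelˡ (block 3F) (length-++-cancelˡ (block 2F)
      (length-++-cancelˡ (block 1F) (length-++-cancelˡ (block 0F) len))))

count-just⇒↭ : (ls ls′ : List Label) → length ls ≡ length ls′ →
  (∀ k → count (just k) ls ≡ count (just k) ls′) → ls ↭ ls′
count-just⇒↭ ls ls′ len cnt = ↭-trans (↭-blocks ls) (↭-trans (↭-reflexive blocks≡) (↭-sym (↭-blocks ls′)))
  where
  blocks≡ = blocks-length-injective (λ l → count l ls) (λ l → count l ls′) cnt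
    (trans (sym (↭-length (↭-blocks ls))) (trans len (↭-length (↭-blocks ls′))))

-- Partitions induced by triples

SamePartition : (Fin n → A) → (Fin n → B) → Set
SamePartition u w = ∀ i j → u i ≡ u j ⇔ w i ≡ w j

-- Points of u are sent to those of w one at a time; correcting the image of the
-- newest by a transposition leaves the earlier ones in place, also when the
-- newest repeats one of them, since then the transposition is trivial.
samePartition⇒permutation : (u w : Fin m → Fin n) → SamePartition u w →
  ∃ λ (π : Permutation′ n) → ∀ i → w i ≡ π ⟨$⟩ʳ u i
samePartition⇒permutation {m = ℕ.zero} u w same = Perm.id , λ ()
samePartition⇒permutation {m = ℕ.suc m} {n = n} u w same
  with π , w≡πu ← samePartition⇒permutation (u ∘ suc) (w ∘ suc) (λ i j → same (suc i) (suc j))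
  = π ∘ₚ transpose p q , λ
    { 0F → sym transpose-left
    ; (suc i) → trans (sym (transpose-fixes i)) (cong (transpose p q ⟨$⟩ʳ_) (w≡πu i)) }
  where
  p q : Fin n
  p = π ⟨$⟩ʳ u 0F
  q = w 0F
  transpose-left : transpose p q ⟨$⟩ʳ p ≡ q
  transpose-left rewrite dec-true (p Fin.≟ p) refl = refl
  transpose-fixes : ∀ i → transpose p q ⟨$⟩ʳ w (suc i) ≡ w (suc i)
  transpose-fixes i with w (suc i) Fin.≟ p
  ... | yes wi≡p = forward (same 0F (suc i))
                     (Injection.injective (↔⇒↣ π) (trans (sym wi≡p) (w≡πu i)))
  ... | no _ with w (suc i) Fin.≟ q
  ...   | yes wi≡q = trans (cong (π ⟨$⟩ʳ_) (sym (backward (same (suc i) 0F) wi≡q))) (sym (w≡πu i))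
  ...   | no _     = refl

V↔Fin3 : (a : Attribute) → V a ↔ Fin 3
V↔Fin3 a = mk↔ₛ′ index (value a) (index-value a)
  (λ x → index-injective _ x (index-value a (index x)))
  where
  value : ∀ a → Fin 3 → V a
  value color  0F = red
  value color  1F = green
  value color  2F = purple
  value shape  0F = oval
  value shape  1F = diamond
  value shape  2F = squiggle
  value fill   0F = solid
  value fill   1F = empty
  value fill   2F = stripe
  value number 0F = single
  value number 1F = double
  value number 2F = triple
  index-value : ∀ a i → index (value a i) ≡ i
  index-value color  0F = refl
  index-value color  1F = refl
  index-value color  2F = refl
  index-value shape  0F = refl
  index-value shape  1F = refl
  index-value shape  2F = refl
  index-value fill   0F = refl
  index-value fill   1F = refl
  index-value fill   2F = refl
  index-value number 0F = refl
  index-value number 1F = refl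
  index-value number 2F = refl

-- Read through `index`, both families take values in `Fin 3`, where the matching of the values that
-- occur extends to a permutation. Conversely, a bijection preserves and reflects equality.
samePartition⇔bijection : (u : Fin n → V a) (w : Fin n → V b) →
  SamePartition u w ⇔ ∃ λ (ϑ : V a ↔ V b) → ∀ i → w i ≡ Inverse.to ϑ (u i)
samePartition⇔bijection {a = a} {b = b} u w = mk⇔ bijection samePartition
  where
  bijection : SamePartition u w → ∃ λ (ϑ : V a ↔ V b) → ∀ i → w i ≡ Inverse.to ϑ (u i)
  bijection same
    with π , eq ← samePartition⇒permutation (index ∘ u) (index ∘ w)
           (λ i j → mk⇔ (cong index ∘ forward (same i j) ∘ index-injective _ _)
                        (cong index ∘ backward (same i j) ∘ index-injective _ _))
    = ↔-trans (V↔Fin3 a) (↔-trans π (↔-sym (V↔Fin3 b)))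
    , λ i → trans (sym (Inverse.strictlyInverseʳ (V↔Fin3 b) (w i)))
                  (cong (Inverse.from (V↔Fin3 b)) (eq i))
  samePartition : (∃ λ (ϑ : V a ↔ V b) → ∀ i → w i ≡ Inverse.to ϑ (u i)) → SamePartition u w
  samePartition (ϑ , eq) i j = mk⇔
    (λ ui≡uj → trans (eq i) (trans (cong (Inverse.to ϑ) ui≡uj) (sym (eq j))))
    (λ wi≡wj → Injection.injective (↔⇒↣ ϑ) (trans (sym (eq i)) (trans wi≡wj (eq j))))

-- The partitions of three points

Constant : (Fin 3 → A) → Set
Constant u = ∀ i j → u i ≡ u j

-- Quantifying over all indices other than `k`, rather than naming the remaining two, keeps the
-- condition symmetric under renumbering the cards.
OddOneOut : (Fin 3 → A) → Fin 3 → Set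
OddOneOut u k = (∀ i j → i ≢ k → j ≢ k → u i ≡ u j) × ¬ Constant u

Cell : (Fin 3 → A) → Fin 4 → Set
Cell u 0F      = Constant u
Cell u (suc k) = OddOneOut u k

constant? : (u : Fin 3 → V a) → Dec (Constant u)
constant? u = all? λ i → all? λ j → u i ≟ u j

cell? : (u : Fin 3 → V a) → Decidable (Cell u)
cell? u 0F      = constant? u
cell? u (suc k) =
  (all? λ i → all? λ j → ¬? (i Fin.≟ k) →-dec ¬? (j Fin.≟ k) →-dec u i ≟ u j) ×-dec ¬? (constant? u)

avoid : (i j : Fin 3) → ∃ λ k → i ≢ k × j ≢ k
avoid = toWitness {a? = all? λ i → all? λ j → any? λ k → ¬? (i Fin.≟ k) ×-dec ¬? (j Fin.≟ k)} _

others : (k i j : Fin 3) → i ≢ k → j ≢ k → i ≢ j → ∀ l → l ≢ k → l ≡ i ⊎ l ≡ j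
others = toWitness {a? = all? λ k → all? λ i → all? λ j →
  ¬? (i Fin.≟ k) →-dec ¬? (j Fin.≟ k) →-dec ¬? (i Fin.≟ j) →-dec
  all? λ l → ¬? (l Fin.≟ k) →-dec (l Fin.≟ i ⊎-dec l Fin.≟ j)} _

-- Only `i` and `j` differ from `k`, so their one equality settles all the others.
agree-off : (u : Fin 3 → A) {k i j : Fin 3} → i ≢ k → j ≢ k → i ≢ j → u i ≡ u j →
  ∀ i′ j′ → i′ ≢ k → j′ ≢ k → u i′ ≡ u j′
agree-off u {k} {i} {j} i≢k j≢k i≢j ui≡uj i′ j′ i′≢k j′≢k =
  trans (to-i i′ i′≢k) (sym (to-i j′ j′≢k))
  where
  to-i : ∀ l → l ≢ k → u l ≡ u i
  to-i l l≢k with others k i j i≢k j≢k i≢j l l≢k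
  ... | inj₁ l≡i = cong u l≡i
  ... | inj₂ l≡j = trans (cong u l≡j) (sym ui≡uj)

-- Two agreeing pairs with different left-out indices share the third index `m`, so every value
-- would equal the one at `m` and `u` would be constant.
cell-disjoint : (u : Fin 3 → A) {k l : Fin 4} → Cell u k → Cell u l → k ≡ l
cell-disjoint u {0F}    {0F}    _       _ = refl
cell-disjoint u {0F}    {suc l} const (_ , ¬const) = contradiction const ¬const
cell-disjoint u {suc k} {0F}    (_ , ¬const) const = contradiction const ¬const
cell-disjoint u {suc k} {suc l} (off-k , ¬const) (off-l , _) with k Fin.≟ l
... | yes k≡l = cong suc k≡l
... | no  k≢l with m , k≢m , l≢m ← avoid k l =
  contradiction (λ i j → trans (to-m i) (sym (to-m j))) ¬const
  where
  to-m : ∀ i → u i ≡ u m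
  to-m i with i Fin.≟ k
  ... | no  i≢k = off-k i m i≢k (k≢m ∘ sym)
  ... | yes i≡k = off-l i m (k≢l ∘ trans (sym i≡k)) (l≢m ∘ sym)

samePartition⇒cell : (u : Fin 3 → A) (w : Fin 3 → B) → SamePartition u w →
  ∀ k → Cell u k → Cell w k
samePartition⇒cell u w same 0F      const = λ i j → forward (same i j) (const i j)
samePartition⇒cell u w same (suc k) (off-k , ¬const) =
  (λ i j i≢k j≢k → forward (same i j) (off-k i j i≢k j≢k)) ,
  (λ const → ¬const λ i j → backward (same i j) (const i j))

-- An agreement between two distinct indices places `u` either in the constant cell or in the cell
-- of the third index, so the four cells determine every agreement.
cell⇒agree : (u : Fin 3 → V a) (w : Fin 3 → B) → (∀ k → Cell u k → Cell w k) →
  ∀ i j → u i ≡ u j → w i ≡ w j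
cell⇒agree u w cells i j ui≡uj with i Fin.≟ j | constant? u
... | yes i≡j | _         = cong w i≡j
... | no  _   | yes const = cells 0F const i j
... | no  i≢j | no ¬const with k , i≢k , j≢k ← avoid i j =
  proj₁ (cells (suc k) (agree-off u i≢k j≢k i≢j ui≡uj , ¬const)) i j i≢k j≢k

-- Renumbering by `σ` preserves constancy and carries the odd index `k` to its image under `σ`;
-- `lift₀ σ` is this action on cells.
cell-permute : (u : Fin 3 → A) (σ : Permutation′ 3) (k : Fin 4) →
  Cell (u ∘ (σ ⟨$⟩ʳ_)) k ⇔ Cell u (lift₀ σ ⟨$⟩ʳ k)
cell-permute u σ 0F      = mk⇔ constant-unpermute (λ const i j → const _ _)
  where
  constant-unpermute : Constant (u ∘ (σ ⟨$⟩ʳ_)) → Constant u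
  constant-unpermute const i j =
    subst₂ (λ i j → u i ≡ u j) (Perm.inverseʳ σ) (Perm.inverseʳ σ) (const (σ Perm.⟨$⟩ˡ i) (σ Perm.⟨$⟩ˡ j))
cell-permute u σ (suc k) = mk⇔
  (λ (off-k , ¬const) →
    (λ i j i≢σk j≢σk → subst₂ (λ i j → u i ≡ u j) (Perm.inverseʳ σ) (Perm.inverseʳ σ)
      (off-k _ _ (unpermute-≢ i≢σk) (unpermute-≢ j≢σk))) ,
    ¬const ∘ backward (cell-permute u σ 0F))
  (λ (off-σk , ¬const) →
    (λ i j i≢k j≢k → off-σk _ _ (i≢k ∘ Injection.injective (↔⇒↣ σ)) (j≢k ∘ Injection.injective (↔⇒↣ σ))) ,
    ¬const ∘ forward (cell-permute u σ 0F))
  where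
  unpermute-≢ : ∀ {i} → i ≢ σ ⟨$⟩ʳ k → σ Perm.⟨$⟩ˡ i ≢ k
  unpermute-≢ i≢σk σ⁻¹i≡k = i≢σk (trans (sym (Perm.inverseʳ σ)) (cong (σ ⟨$⟩ʳ_) σ⁻¹i≡k))

-- Counting attributes

Fin4↔Attribute : Fin 4 ↔ Attribute
Fin4↔Attribute = mk↔ₛ′
  (λ { 0F → color ; 1F → shape ; 2F → fill ; 3F → number })
  (λ { color → 0F ; shape → 1F ; fill → 2F ; number → 3F })
  (λ { color → refl ; shape → refl ; fill → refl ; number → refl })
  (λ { 0F → refl ; 1F → refl ; 2F → refl ; 3F → refl })

attribute : Fin 4 → Attribute
attribute = Inverse.to Fin4↔Attribute

#attributes-cong : {P Q : Pred Attribute 0ℓ} (P? : Decidable P) (Q? : Decidable Q) →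
  (∀ a → P a ⇔ Q a) → #attributes P? ≡ #attributes Q?
#attributes-cong P? Q? P⇔Q = cong length
  (filter-≐ P? Q? ((λ {a} → forward (P⇔Q a)) , (λ {a} → backward (P⇔Q a))) attributes)

#attributes-permute : {P : Pred Attribute 0ℓ} (P? : Decidable P) (ψ : Attribute ↔ Attribute) →
  #attributes (P? ∘ Inverse.to ψ) ≡ #attributes P?
#attributes-permute P? ψ = trans (sym (length-filter-map P? (Inverse.to ψ) attributes))
  (↭-length (filter-↭ P? ψ-attributes))
  where
  π : Permutation′ 4
  π = ↔-trans Fin4↔Attribute (↔-trans ψ (↔-sym Fin4↔Attribute))
  ψ-attributes : map (Inverse.to ψ) attributes ↭ attributes
  -- By computation `attributes` is `tabulate attribute`, and `ψ` acts on its indices as `π`.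
  ψ-attributes = ↭-sym (↭-trans (tabulate-permute attribute π)
    (↭-reflexive (tabulate-cong
      (λ i → Inverse.strictlyInverseˡ Fin4↔Attribute (Inverse.to ψ (attribute i))))))

column : (Fin 3 → Card) → (a : Attribute) → Fin 3 → V a
column x a i = v a (x i)

InCell : (Fin 3 → Card) → Fin 4 → Pred Attribute 0ℓ
InCell x k a = Cell (column x a) k

inCell? : (x : Fin 3 → Card) (k : Fin 4) → Decidable (InCell x k)
inCell? x k a = cell? (column x a) k

#cell : (Fin 3 → Card) → Fin 4 → ℕ
#cell x k = #attributes (inCell? x k)

allAgree⇔constant : (x : Fin 3 → Card) (a : Attribute) →
  AllAgree (x 0F) (x 1F) (x 2F) a ⇔ Constant (column x a)
allAgree⇔constant x a = mk⇔
  (λ agree i j → trans (to-1 agree i) (sym (to-1 agree j)))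
  (λ const → const 0F 1F , const 1F 2F)
  where
  to-1 : AllAgree (x 0F) (x 1F) (x 2F) a → ∀ i → column x a i ≡ column x a 1F
  to-1 (eq , _) 0F = eq
  to-1 _        1F = refl
  to-1 (_ , eq) 2F = sym eq

-- When the cards `i` and `j` agree but not all three do, the remaining card `k` is the odd one out.
-- Each `pᵢ` is thus the count of a cell.
#onlyPairAgree : (x : Fin 3 → Card) {k i j : Fin 3} → i ≢ k → j ≢ k → i ≢ j →
  #attributes (onlyPairAgree? (x 0F) (x 1F) (x 2F) (x i) (x j)) ≡ #cell x (suc k)
#onlyPairAgree x {k} {i} {j} i≢k j≢k i≢j = #attributes-cong
  (onlyPairAgree? (x 0F) (x 1F) (x 2F) (x i) (x j)) (inCell? x (suc k)) λ a → mk⇔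
  (λ (eq , ¬agree) →
    agree-off (column x a) i≢k j≢k i≢j eq , ¬agree ∘ backward (allAgree⇔constant x a))
  (λ (off-k , ¬const) → off-k i j i≢k j≢k , ¬const ∘ forward (allAgree⇔constant x a))

-- The pᵢ are listed by pairs {1,2}, {1,3}, {2,3}, so the cells 1, 2, 3 of the
-- left-out cards appear in reverse.
cellSymbol : (Fin 4 → ℕ) → Symbol
cellSymbol c = ⟨ c 0F ⨾ c 3F , c 2F , c 1F ⟩

symbol-#cell : (x : Fin 3 → Card) →
  symbolOf (x 0F) (x 1F) (x 2F) ≡ cellSymbol (#cell x)
symbol-#cell x
  rewrite #attributes-cong (allAgree? (x 0F) (x 1F) (x 2F)) (inCell? x 0F)
            (allAgree⇔constant x)
        | #onlyPairAgree x {2F} {0F} {1F} (λ ()) (λ ()) (λ ())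
        | #onlyPairAgree x {1F} {0F} {2F} (λ ()) (λ ()) (λ ())
        | #onlyPairAgree x {0F} {1F} {2F} (λ ()) (λ ()) (λ ())
  = refl

-- Equality of the multisets of `pᵢ` amounts to a permutation of the three left-out cards; `lift₀`
-- makes it fix cell 0, which is counted by `t`.
cellSymbol≈⇔permutation : (c c′ : Fin 4 → ℕ) →
  cellSymbol c ≈ cellSymbol c′ ⇔ ∃ λ (σ : Permutation′ 3) → ∀ k → c k ≡ c′ (lift₀ σ ⟨$⟩ʳ k)
cellSymbol≈⇔permutation c c′ = mk⇔ match unmatch
  where
  p : (Fin 4 → ℕ) → List ℕ
  p c = c 3F ∷ c 2F ∷ c 1F ∷ []
  match : cellSymbol c ≈ cellSymbol c′ →
    ∃ λ (σ : Permutation′ 3) → ∀ k → c k ≡ c′ (lift₀ σ ⟨$⟩ʳ k)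
  match (t≡ , p↭)
    with σ , eq ← tabulate-↭⇒permutation (c ∘ suc) (c′ ∘ suc)
           (↭-trans (↭-reverse (p c)) (↭-trans p↭ (↭-sym (↭-reverse (p c′)))))
    = σ , λ { 0F → t≡ ; (suc k) → eq k }
  unmatch : (∃ λ (σ : Permutation′ 3) → ∀ k → c k ≡ c′ (lift₀ σ ⟨$⟩ʳ k)) →
    cellSymbol c ≈ cellSymbol c′
  unmatch (σ , eq) = eq 0F , ↭-trans (↭-sym (↭-reverse (p c)))
    (↭-trans (↭-reflexive (tabulate-cong (eq ∘ suc)))
      (↭-trans (↭-sym (tabulate-permute (c′ ∘ suc) σ)) (↭-reverse (p c′))))

symbol≈⇔#cell : (x y : Fin 3 → Card) →
  symbolOf (x 0F) (x 1F) (x 2F) ≈ symbolOf (y 0F) (y 1F) (y 2F) ⇔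
  ∃ λ (σ : Permutation′ 3) → ∀ k → #cell x k ≡ #cell y (lift₀ σ ⟨$⟩ʳ k)
symbol≈⇔#cell x y = subst₂
  (λ s s′ → s ≈ s′ ⇔ ∃ λ (σ : Permutation′ 3) → ∀ k → #cell x k ≡ #cell y (lift₀ σ ⟨$⟩ʳ k))
  (sym (symbol-#cell x)) (sym (symbol-#cell y))
  (cellSymbol≈⇔permutation (#cell x) (#cell y))

#cell-permute : (y : Fin 3 → Card) (σ : Permutation′ 3) (k : Fin 4) →
  #cell (y ∘ (σ ⟨$⟩ʳ_)) k ≡ #cell y (lift₀ σ ⟨$⟩ʳ k)
#cell-permute y σ k = #attributes-cong (inCell? (y ∘ (σ ⟨$⟩ʳ_)) k) (inCell? y (lift₀ σ ⟨$⟩ʳ k))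
  λ a → cell-permute (column y a) σ k

-- Matching attributes

label : (Fin 3 → Card) → Attribute → Label
label x a with any? (cell? (column x a))
... | yes (k , _) = just k
... | no  _       = nothing

-- The search in `label` returns some cell that holds; disjointness identifies it with a given cell
-- `k`.
label⇔cell : (x : Fin 3 → Card) (a : Attribute) (k : Fin 4) →
  just k ≡ label x a ⇔ Cell (column x a) k
label⇔cell x a k with any? (cell? (column x a))
... | yes (l , cell-l) = mk⇔
  (λ eq → subst (Cell (column x a)) (sym (just-injective eq)) cell-l)
  (λ cell-k → cong just (cell-disjoint (column x a) cell-k cell-l))
... | no  ∄cell        = mk⇔ (λ ()) (λ cell-k → contradiction (k , cell-k) ∄cell)

label⇒samePartition : (x y : Fin 3 → Card) (a b : Attribute) → label x a ≡ label y b →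
  SamePartition (column x a) (column y b)
label⇒samePartition x y a b eq i j = mk⇔
  (cell⇒agree (column x a) (column y b)
    (λ k c → forward (label⇔cell y b k) (trans (backward (label⇔cell x a k) c) eq)) i j)
  (cell⇒agree (column y b) (column x a)
    (λ k c → forward (label⇔cell x a k) (trans (backward (label⇔cell y b k) c) (sym eq))) i j)

count-label : (x : Fin 3 → Card) (k : Fin 4) →
  count (just k) (map (label x) attributes) ≡ #cell x k
count-label x k = trans (length-filter-map (just k ≟ˡ_) (label x) attributes)
  (#attributes-cong ((just k ≟ˡ_) ∘ label x) (inCell? x k) λ a → label⇔cell x a k)

match-labels : (f g : Attribute → Label) →
  (∀ k → count (just k) (map f attributes) ≡ count (just k) (map g attributes)) →
  ∃ λ (ψ : Attribute ↔ Attribute) → f ≗ g ∘ Inverse.to ψ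
match-labels f g count≡
  with π , eq ← tabulate-↭⇒permutation (f ∘ attribute) (g ∘ attribute)
         -- Both lists have four entries by computation, and this total fixes the count of
         -- `nothing`.
         (count-just⇒↭ (map f attributes) (map g attributes) refl count≡)
  = ↔-trans (↔-sym Fin4↔Attribute) (↔-trans π Fin4↔Attribute)
  , λ a → trans (cong f (sym (Inverse.strictlyInverseˡ Fin4↔Attribute a))) (eq _)

-- The attribute half of an isomorphism once the cards are matched by position: each bijection `ϑ a`
-- is replaced by the condition for its existence.
Matching : (x y : Fin 3 → Card) → Attribute ↔ Attribute → Set
Matching x y ψ = ∀ a → SamePartition (column x a) (column y (Inverse.to ψ a))

matching⇒#cell : (x y : Fin 3 → Card) (ψ : Attribute ↔ Attribute) → Matching x y ψ →
  ∀ k → #cell x k ≡ #cell y k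
matching⇒#cell x y ψ same k = trans
  (#attributes-cong (inCell? x k) (inCell? y k ∘ Inverse.to ψ) λ a → mk⇔
    (samePartition⇒cell _ _ (same a) k)
    (samePartition⇒cell _ _ (λ i j → ⇔-sym (same a i j)) k))
  (#attributes-permute (inCell? y k) ψ)

#cell⇒matching : (x y : Fin 3 → Card) → (∀ k → #cell x k ≡ #cell y k) → ∃ (Matching x y)
#cell⇒matching x y #cell≡ =
  map₂ (λ {ψ} eq a → label⇒samePartition x y a (Inverse.to ψ a) (eq a))
    (match-labels (label x) (label y) count≡)
  where
  count≡ : ∀ k → count (just k) (map (label x) attributes) ≡ count (just k) (map (label y) attributes)
  count≡ k = trans (count-label x k) (trans (#cell≡ k) (sym (count-label y k)))

-- Isomorphisms as matchings

cards : {H : Hand} → ThreeCards H → Fin 3 → Card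
cards e i = ⌊ Inverse.to e i ⌋

-- Through the two enumerations `φ` becomes a permutation `σ` of positions, and each `ϑ a` is traded
-- for an equality of partitions.
isomorphic⇔matching : {H H′ : Hand} (e : ThreeCards H) (e′ : ThreeCards H′) →
  Isomorphic H H′ ⇔
  ∃ λ (σ : Permutation′ 3) → ∃ (Matching (cards e) (cards e′ ∘ (σ ⟨$⟩ʳ_)))
isomorphic⇔matching {H} {H′} e e′ = mk⇔ match unmatch
  where
  match : Isomorphic H H′ → ∃ λ (σ : Permutation′ 3) → ∃ (Matching (cards e) (cards e′ ∘ (σ ⟨$⟩ʳ_)))
  match iso = ↔-trans e (↔-trans φ (↔-sym e′)) , ψ , λ a →
    backward (samePartition⇔bijection _ _)
      (ϑ a , λ i → trans (cong (v _ ∘ ⌊_⌋) (Inverse.strictlyInverseˡ e′ _))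
                         (compatible a (Inverse.to e i)))
    where open Isomorphic iso
  unmatch : (∃ λ (σ : Permutation′ 3) → ∃ (Matching (cards e) (cards e′ ∘ (σ ⟨$⟩ʳ_)))) → Isomorphic H H′
  unmatch (σ , ψ , same) = record
    { φ = ↔-trans (↔-sym e) (↔-trans σ e′)
    ; ψ = ψ
    ; ϑ = λ a → proj₁ (bijection a)
    -- Compatibility is known by position; it is used at the position of `x`, and the card there is
    -- that of `x` again.
    ; compatible = λ a x → trans (proj₂ (bijection a) (Inverse.from e x))
        (cong (Inverse.to (proj₁ (bijection a)) ∘ v a ∘ ⌊_⌋) (Inverse.strictlyInverseˡ e x))
    }
    where
    bijection : ∀ a → _
    bijection a = forward (samePartition⇔bijection _ _) (same a)

theorem1 : (H H′ : Hand) (e : ThreeCards H) (e′ : ThreeCards H′) →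
    Isomorphic H H′ ⇔ (symbol e ≈ symbol e′)
theorem1 H H′ e e′ = mk⇔
  (λ iso → let σ , ψ , same = forward (isomorphic⇔matching e e′) iso in
    backward (symbol≈⇔#cell x y)
      -- Re-enumerating `H′` along `σ` moves its cell counts by `lift₀ σ`.
      (σ , λ k → trans (matching⇒#cell x _ ψ same k) (#cell-permute y σ k)))
  (λ eq → let σ , #cell≡ = forward (symbol≈⇔#cell x y) eq in
    backward (isomorphic⇔matching e e′)
      (σ , #cell⇒matching x _ (λ k → trans (#cell≡ k) (sym (#cell-permute y σ k)))))
  where
  x y : Fin 3 → Card
  x = cards e
  y = cards e′
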